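{- Let $G$ and $H$ be connected graphs with $|G|>1$ and $|H|>1$ (number of vertices). For the cop and killer game: (1) the Cartesian product $G\,\square\,H$ is a stalemate if at least one of $G$ and $H$ is not a tree; (2) the tensor product $G\times H$ is a stalemate if both $G$ and $H$ are not killer-win, and is killer-win otherwise; (3) the strong product $G\boxtimes H$ is cop-win if both $G$ and $H$ have a universal vertex, and is a stalemate otherwise.
   Context: A universal vertex is one adjacent to all other vertices. All three products have vertex set $V(G)\times V(H)$; write $\sim$ for adjacency. In $G\,\square\,H$, $(g,h)\sim(g',h')$ iff ($g=g'$ and $h\sim h'$) or ($g\sim g'$ and $h=h'$). In $G\times H$, $(g,h)\sim(g',h')$ iff $g\sim g'$ and $h\sim h'$. In $G\boxtimes H$, the edges are those of $G\,\square\,H$ together with those of $G\times H$. The cop and killer game on a graph is the following perfect-information game. The cop and the killer each pick a vertex, the killer choosing after seeing the cop's choice. Then the game begins, with the cop going first: she moves to an adjacent vertex, then the killer moves to an adjacent vertex, and so on alternately. If after the cop moves she occupies the vertex where the killer is located, she wins. If after the killer moves he occupies the vertex where the cop is located, he wins. If neither happens after an infinite number of turns, it is a stalemate. A graph is cop-win if the cop wins, killer-win if the killer wins, and stalemate if the game is a stalemate, when both play optimally.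
   Formalization: The killer must start on a vertex different from the cop's; otherwise he could start on her vertex, follow her first move and win on every graph considered, so the stated results would fail. -}

module Defs where

open import Data.Fin using (Fin; zero; suc; inject₁; fromℕ)
open import Data.Fin.Properties using (inj⇒≟; *↔×)
open import Data.List using (List; []; _∷_)
open import Data.Nat using (ℕ; zero; suc; _+_; _*_; _≤_; _<_)
open import Data.Product using (Σ; ∃; ∃-syntax; _×_; _,_; proj₁; proj₂)
open import Data.Product.Function.NonDependent.Propositional using (_×-↔_)
open import Data.Sum using (_⊎_; inj₁; inj₂; [_,_])
open import Function.Bundles using (_↔_)
open import Function.Definitions using (Injective)
open import Function.Properties.Inverse using (↔-sym; ↔-trans; ↔⇒↣)
open import Level using (0ℓ)
open import Relation.Binary.Core using (Rel)
open import Relation.Binary.Construct.Closure.ReflexiveTransitive using (Star)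
open import Relation.Binary.Definitions
  using (Decidable; DecidableEquality; Symmetric)
open import Relation.Binary.PropositionalEquality using (_≡_; _≢_; sym)
open import Relation.Nullary using (¬_)
open import Relation.Nullary.Decidable using (_×-dec_; _⊎-dec_)

-- Finite simple graphs.
record Graph : Set₁ where
  infix 4 _~_ _~?_
  field
    V       : Set
    order   : ℕ
    finite  : V ↔ Fin order
    _~_     : Rel V 0ℓ
    _~?_    : Decidable _~_
    ~-sym   : Symmetric _~_
    ~-irrefl : ∀ {v} → ¬ (v ~ v)

  _≟_ : DecidableEquality V
  _≟_ = inj⇒≟ (↔⇒↣ finite)

∣_∣ᵍ : Graph → ℕ
∣ G ∣ᵍ = Graph.order G

Connected : Graph → Set
Connected G = ∀ u v → Star _~_ u v
  where open Graph G

-- A cycle lists at least three distinct vertices.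
record Cycle (G : Graph) : Set where
  open Graph G
  field
    k         : ℕ
    vertex    : Fin (3 + k) → V
    injective : Injective _≡_ _≡_ vertex
    step      : ∀ (i : Fin (2 + k)) → vertex (inject₁ i) ~ vertex (suc i)
    close     : vertex (fromℕ (2 + k)) ~ vertex zero

IsTree : Graph → Set
IsTree G = Connected G × ¬ Cycle G

HasUniversalVertex : Graph → Set
HasUniversalVertex G = ∃[ u ] (∀ v → v ≢ u → u ~ v)
  where open Graph G

module _ (G H : Graph) where
  private
    module G = Graph G
    module H = Graph H

    product-finite : (G.V × H.V) ↔ Fin (G.order * H.order)
    product-finite = ↔-trans (G.finite ×-↔ H.finite) (↔-sym *↔×)

  CartesianAdj TensorAdj StrongAdj : Rel (G.V × H.V) 0ℓ
  CartesianAdj (g , h) (g′ , h′) = (g ≡ g′ × h H.~ h′) ⊎ (g G.~ g′ × h ≡ h′)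
  TensorAdj    (g , h) (g′ , h′) = g G.~ g′ × h H.~ h′
  StrongAdj    x       y         = CartesianAdj x y ⊎ TensorAdj x y

  private
    cartesian? : Decidable CartesianAdj
    cartesian? (g , h) (g′ , h′) =
      ((g G.≟ g′) ×-dec (h H.~? h′)) ⊎-dec ((g G.~? g′) ×-dec (h H.≟ h′))

    tensor? : Decidable TensorAdj
    tensor? (g , h) (g′ , h′) = (g G.~? g′) ×-dec (h H.~? h′)

    cartesian-sym : Symmetric CartesianAdj
    cartesian-sym (inj₁ (p , q)) = inj₁ (sym p , H.~-sym q)
    cartesian-sym (inj₂ (p , q)) = inj₂ (G.~-sym p , sym q)

    tensor-sym : Symmetric TensorAdj
    tensor-sym (p , q) = G.~-sym p , H.~-sym q

    cartesian-irrefl : ∀ {x} → ¬ CartesianAdj x x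
    cartesian-irrefl (inj₁ (_ , q)) = H.~-irrefl q
    cartesian-irrefl (inj₂ (p , _)) = G.~-irrefl p

    tensor-irrefl : ∀ {x} → ¬ TensorAdj x x
    tensor-irrefl (p , _) = G.~-irrefl p

  infixl 7 _□_ _⊗_ _⊠_

  _□_ : Graph
  _□_ = record
    { finite = product-finite ; _~_ = CartesianAdj ; _~?_ = cartesian?
    ; ~-sym = cartesian-sym ; ~-irrefl = cartesian-irrefl }

  -- The tensor product.
  _⊗_ : Graph
  _⊗_ = record
    { finite = product-finite ; _~_ = TensorAdj ; _~?_ = tensor?
    ; ~-sym = tensor-sym ; ~-irrefl = tensor-irrefl }

  _⊠_ : Graph
  _⊠_ = record
    { finite = product-finite ; _~_ = StrongAdj
    ; _~?_ = λ x y → cartesian? x y ⊎-dec tensor? x y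
    ; ~-sym = λ { (inj₁ p) → inj₁ (cartesian-sym p)
                ; (inj₂ p) → inj₂ (tensor-sym p) }
    ; ~-irrefl = [ cartesian-irrefl , tensor-irrefl ] }

-- The cop and killer game.  Passing is not allowed, so the game is meant for
-- graphs without isolated vertices; otherwise the strategy types are empty.
module Game (G : Graph) where
  open Graph G

  -- The positions (cop , killer) at the beginning of the earlier rounds, most
  -- recent first.  Together with the current position this is the whole
  -- history of the game, as the cop's move in a round is read off the next
  -- position.
  History : Set
  History = List (V × V)

  record CopStrategy : Set where
    field
      start : V
      move  : History → (c k : V) → ∃[ c′ ] c ~ c′

  -- The killer must start on a vertex other than the cop's: were he to start
  -- on hers, he would win by moving to wherever she moves.
  -- In move, c′ is the vertex the cop has just moved to from c.
  record KillerStrategy : Set where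
    field
      start : (c : V) → ∃[ k ] k ≢ c
      move  : History → (c k c′ : V) → ∃[ k′ ] k ~ k′

  module Play (σ : CopStrategy) (τ : KillerStrategy) where
    private
      module σ = CopStrategy σ
      module τ = KillerStrategy τ

    -- History and position at the beginning of round i.  The recursion runs
    -- on past a capture; the outcome depends only on the first capture.
    round : ℕ → History × V × V
    round zero    = [] , σ.start , proj₁ (τ.start σ.start)
    round (suc i) =
      let past , c , k = round i
          c′ = proj₁ (σ.move past c k)
          k′ = proj₁ (τ.move past c k c′)
      in (c , k) ∷ past , c′ , k′

    cop killer : ℕ → V
    cop    i = proj₁ (proj₂ (round i))
    killer i = proj₂ (proj₂ (round i))

    CopCatches KillerCatches : ℕ → Set
    CopCatches    i = cop (suc i) ≡ killer i
    KillerCatches i = killer (suc i) ≡ cop (suc i)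

    -- The cop moves first in each round, hence j < i here and j ≤ i below.
    CopWins : Set
    CopWins = ∃[ i ] CopCatches i × (∀ j → j < i → ¬ KillerCatches j)

    KillerWins : Set
    KillerWins = ∃[ i ] KillerCatches i × (∀ j → j ≤ i → ¬ CopCatches j)

  open Play public using (CopWins; KillerWins)

-- The result under optimal play: a win if one player can force it, and a
-- stalemate if each player can make sure not to lose.
module _ (G : Graph) where
  open Game G

  CopWin KillerWin Stalemate : Set
  CopWin    = Σ CopStrategy λ σ → ∀ τ → CopWins σ τ
  KillerWin = Σ KillerStrategy λ τ → ∀ σ → KillerWins σ τ
  Stalemate = (Σ CopStrategy λ σ → ∀ τ → ¬ KillerWins σ τ)
            × (Σ KillerStrategy λ τ → ∀ σ → ¬ CopWins σ τ)

{-# OPTIONS --safe #-}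
module Submission where

open import Defs
open import Data.Empty using (⊥)
open import Data.Fin using (Fin; zero; suc; inject₁; fromℕ; fromℕ<)
import Data.Fin.Properties as Fin
open import Data.Fin.Relation.Unary.Top using (view; ‵fromℕ; ‵inject₁)
open import Data.Fin.Subset using (Subset; _∈_; _⊂_; _⊃_)
open import Data.Fin.Subset.Induction using (⊃-wellFounded)
open import Data.Fin.Subset.Properties using (_∈?_; anySubset?)
open import Data.List using (length)
open import Data.Nat using (ℕ; zero; suc; _+_; _∸_; _<_; s≤s)
import Data.Nat.Properties as ℕ
open import Data.Product using (Σ; ∃; _×_; _,_; proj₁; proj₂; swap)
open import Data.Sum using (_⊎_; inj₁; inj₂; [_,_]′; map₂)
open import Data.Unit using (⊤; tt)
open import Data.Vec using (tabulate)
open import Data.Vec.Properties using (lookup∘tabulate; lookup⇒[]=; []=⇒lookup)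
open import Function using (_∘_; _$_; id)
open import Function.Bundles using (_↔_; Inverse)
open import Induction.WellFounded using (Acc; acc)
open import Relation.Binary.Construct.Closure.ReflexiveTransitive using (Star; ε; _◅_)
import Relation.Binary.Definitions as Binary
open import Relation.Binary.PropositionalEquality using (_≡_; _≢_; refl; sym; trans; cong; subst)
open import Relation.Nullary using (¬_; Dec; yes; no; does; contradiction)
open import Relation.Nullary.Decidable
  using (_×-dec_; _⊎-dec_; _→-dec_; ¬?; map′; dec-true; decidable-stable)
open import Relation.Nullary.Negation using (¬¬-map)
open import Relation.Unary using (Decidable)

-- In the Cartesian and strong products a player survives by always moving to
-- a vertex distinct from and not adjacent to the opponent's, unless a capture
-- is available.  In the Cartesian product this is possible as soon
-- as one factor has a subgraph of minimum degree two, in which the player keeps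
-- the coordinate; in the strong product it is possible everywhere, because one
-- of the two coordinates already separates the players and the other one can
-- be moved freely.  In the tensor product the killer can copy the cop's
-- moves in H while playing in G, so he is never caught and wins if he
-- wins on G; and if the cop survives on both factors, then she survives by
-- playing in a factor where the starting positions differ: once she catches the
-- killer in that coordinate, she can follow him there forever.

-- Search over finite types

separate : ∀ {A B : Set} → ¬ (A × B) → Dec A → ¬ A ⊎ ¬ B
separate ¬ab (yes a) = inj₂ (¬ab ∘ (a ,_))
separate ¬ab (no ¬a) = inj₁ ¬a

comprehension : ∀ {n} {P : Fin n → Set} → Decidable P → Subset n
comprehension P? = tabulate (does ∘ P?)

module _ {n} {P : Fin n → Set} (P? : Decidable P) where

  ∈-comprehension⁺ : ∀ {i} → P i → i ∈ comprehension P?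
  ∈-comprehension⁺ {i} p = lookup⇒[]= i _ $
    trans (lookup∘tabulate (does ∘ P?) i) (dec-true (P? i) p)

  ∈-comprehension⁻ : ∀ {i} → i ∈ comprehension P? → P i
  ∈-comprehension⁻ {i} i∈ with P? i | trans (sym (lookup∘tabulate (does ∘ P?) i)) ([]=⇒lookup i∈)
  ... | yes p | _ = p
  ... | no _  | ()

module Finite {A : Set} {n} (A↔Fin : A ↔ Fin n) where
  open Inverse A↔Fin public using (to; from)

  from∘to : ∀ x → from (to x) ≡ x
  from∘to = Inverse.strictlyInverseʳ A↔Fin

  to∘from : ∀ i → to (from i) ≡ i
  to∘from = Inverse.strictlyInverseˡ A↔Fin

  any? : {P : A → Set} → Decidable P → Dec (∃ P)
  any? {P} P? = map′ (λ (i , p) → from i , p)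
                     (λ (x , p) → to x , subst P (sym (from∘to x)) p)
                     (Fin.any? (P? ∘ from))

  all? : {P : A → Set} → Decidable P → Dec (∀ x → P x)
  all? {P} P? = map′ (λ p x → subst P (from∘to x) (p (to x))) (λ p → p ∘ from)
                     (Fin.all? (P? ∘ from))

  ¬∀⇒∃¬ : {P : A → Set} → Decidable P → ¬ (∀ x → P x) → ∃ (¬_ ∘ P)
  ¬∀⇒∃¬ P? ¬∀ = decidable-stable (any? (¬? ∘ P?)) λ ¬∃ →
    ¬∀ λ x → decidable-stable (P? x) (¬∃ ∘ (x ,_))

  module _ (P : ℕ → A → Set) (P? : ∀ m → Decidable (P m))
           (increasing : ∀ m {x} → P m x → P (suc m) x) where

    private
      stage : ℕ → Subset n
      stage m = comprehension (P? m ∘ from)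

      search : ∀ m → Acc _⊃_ (stage m) → ∃ λ N → ∀ x → P (suc N) x → P N x
      search m (acc rec) with any? (λ x → P? (suc m) x ×-dec ¬? (P? m x))
      ... | no ¬new = m , λ x p → decidable-stable (P? m x) (λ ¬p → ¬new (x , p , ¬p))
      ... | yes (x , p , ¬p) = search (suc m) (rec grows)
        where
        grows : stage m ⊂ stage (suc m)
        grows =
            (λ i∈ → ∈-comprehension⁺ (P? (suc m) ∘ from)
                      (increasing m (∈-comprehension⁻ (P? m ∘ from) i∈)))
          , to x
          , ∈-comprehension⁺ (P? (suc m) ∘ from) (subst (P (suc m)) (sym (from∘to x)) p)
          , λ i∈ → ¬p (subst (P m) (from∘to x) (∈-comprehension⁻ (P? m ∘ from) i∈))

    -- A stage that is not yet repeated is a proper subset of the next one, and subsets of a finite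
    -- set have no infinite ascending chain.
    stabilises : ∃ λ N → ∀ x → P (suc N) x → P N x
    stabilises = search 0 (⊃-wellFounded _)

-- Graphs without isolated vertices

NoIsolated : Graph → Set
NoIsolated X = ∀ v → ∃ (v ~_)
  where open Graph X

module _ (X : Graph) where
  open Graph X
  open Finite finite

  some-vertex : 1 < order → V
  some-vertex 1< = from (fromℕ< 1<)

  other-vertex : 1 < order → (v : V) → ∃ (_≢ v)
  other-vertex (s≤s (s≤s _)) v with from zero ≟ v
  ... | no ≢v = from zero , ≢v
  ... | yes refl = from (suc zero) , λ eq →
    contradiction (trans (sym (to∘from (suc zero))) (trans (cong to eq) (to∘from zero))) λ ()

  no-isolated : Connected X → 1 < order → NoIsolated X
  no-isolated conn 1< v =
    let u , u≢v = other-vertex 1< v in first-step (u≢v ∘ sym) (conn v u)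
    where
    first-step : ∀ {u w} → u ≢ w → Star _~_ u w → ∃ (u ~_)
    first-step u≢u ε = contradiction refl u≢u
    first-step _ (u~v ◅ _) = _ , u~v

-- Strategies

module _ (X : Graph) (neighbour : NoIsolated X) where
  open Graph X
  open Finite finite
  open Game X

  -- A strategy must move in every position, so where no move satisfies `P` it falls back on an
  -- arbitrary neighbour.
  respond : ∀ v {P : V → Set} → Decidable P →
    Σ (∃ (v ~_)) λ u → (∃ λ w → v ~ w × P w) → P (proj₁ u)
  respond v P? with any? (λ w → (v ~? w) ×-dec P? w)
  ... | yes (w , v~w , p) = (w , v~w) , λ _ → p
  ... | no ¬∃ = neighbour v , λ ∃p → contradiction ∃p ¬∃

  module _ {J : V → V → Set} (J? : Binary.Decidable J) where

    CopGoal : V → V → Set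
    CopGoal k c′ = c′ ≡ k ⊎ (∀ k′ → k ~ k′ → k′ ≢ c′ × J c′ k′)

    cop-goal? : ∀ k → Decidable (CopGoal k)
    cop-goal? k c′ = (c′ ≟ k) ⊎-dec
      all? λ k′ → (k ~? k′) →-dec (¬? (k′ ≟ c′) ×-dec J? c′ k′)

    -- `J` is an invariant at the beginning of rounds. It may break once the cop has caught the
    -- killer, so the induction assumes no earlier catch, which a supposed win of the killer
    -- supplies.
    cop-survives : (∀ {c k} → J c k → ∃ λ c′ → c ~ c′ × CopGoal k c′) →
      (∃ λ c → ∀ k → k ≢ c → J c k) → Σ CopStrategy λ σ → ∀ τ → ¬ KillerWins σ τ
    cop-survives advance (c₀ , safe) = σ , survives
      where
      σ : CopStrategy
      σ = record { start = c₀ ; move = λ _ c k → proj₁ (respond c (cop-goal? k)) }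

      survives : ∀ τ → ¬ KillerWins σ τ
      survives τ (i , caught , free) =
        [ free i ℕ.≤-refl , (λ f → proj₁ (f _ (killer-moves i)) caught) ]′
          (goal i (invariant i λ j j<i → free j (ℕ.<⇒≤ j<i)))
        where
        open Play σ τ
        module τ = KillerStrategy τ

        killer-moves : ∀ i → killer i ~ killer (suc i)
        killer-moves i =
          proj₂ (τ.move (proj₁ (round i)) (cop i) (killer i) (cop (suc i)))

        goal : ∀ i → J (cop i) (killer i) → CopGoal (killer i) (cop (suc i))
        goal i = proj₂ (respond (cop i) (cop-goal? (killer i))) ∘ advance

        invariant : ∀ i → (∀ j → j < i → ¬ CopCatches j) → J (cop i) (killer i)
        invariant zero _ = safe _ (proj₂ (τ.start c₀))
        invariant (suc i) free =
          [ (λ caught → contradiction caught (free i ℕ.≤-refl))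
          , (λ f → proj₂ (f _ (killer-moves i))) ]′
          (goal i (invariant i λ j → free j ∘ ℕ.m<n⇒m<1+n))

    -- The cop moves along an edge, so by `apart` she cannot catch the killer from a position in
    -- `J`. The invariant is kept until he catches her.
    killer-survives : (∀ {c k} → J c k → ¬ c ~ k) →
      (∀ {c k c′} → J c k → c ~ c′ → ∃ λ k′ → k ~ k′ × (k′ ≡ c′ ⊎ J c′ k′)) →
      (∀ c → ∃ λ k → k ≢ c × J c k) → Σ KillerStrategy λ τ → ∀ σ → ¬ CopWins σ τ
    killer-survives apart advance begin = τ , survives
      where
      goal? : ∀ c′ → Decidable (λ k′ → k′ ≡ c′ ⊎ J c′ k′)
      goal? c′ k′ = (k′ ≟ c′) ⊎-dec J? c′ k′

      τ : KillerStrategy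
      τ = record
        { start = λ c → let k , k≢c , _ = begin c in k , k≢c
        ; move  = λ _ _ k c′ → proj₁ (respond k (goal? c′)) }

      survives : ∀ σ → ¬ CopWins σ τ
      survives σ (i , caught , free) =
        apart (invariant i free) (subst (cop i ~_) caught (cop-moves i))
        where
        open Play σ τ
        module σ = CopStrategy σ

        cop-moves : ∀ i → cop i ~ cop (suc i)
        cop-moves i = proj₂ (σ.move (proj₁ (round i)) (cop i) (killer i))

        invariant : ∀ i → (∀ j → j < i → ¬ KillerCatches j) → J (cop i) (killer i)
        invariant zero _ = proj₂ (proj₂ (begin σ.start))
        invariant (suc i) free =
          [ (λ caught → contradiction caught (free i ℕ.≤-refl)) , id ]′
          (proj₂ (respond (killer i) (goal? (cop (suc i))))
            (advance (invariant i λ j → free j ∘ ℕ.m<n⇒m<1+n) (cop-moves i)))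

-- Here `x` is the player who stays in `S` and `y` the opponent, who may be anywhere. The same set
-- serves cop and killer.
record EvasiveSet (X : Graph) : Set₁ where
  open Graph X
  field
    S      : V → Set
    S?     : Decidable S
    evade  : ∀ {x y} → S x → x ≢ y → ¬ x ~ y → ∃ λ x′ → x ~ x′ × S x′ × ¬ x′ ~ y
    escape : ∀ y → ∃ λ x → S x × x ≢ y × ¬ x ~ y

-- The two invariants differ because the cop moves first in a round: if adjacent to the killer she
-- captures him, so being distinct from him is enough for her, whereas he must also avoid adjacency.
evasive⇒stalemate : (X : Graph) → NoIsolated X → Graph.V X → EvasiveSet X → Stalemate X
evasive⇒stalemate X neighbour v E =
    cop-survives X neighbour {J} (λ c k → S? c ×-dec ¬? (c ≟ k)) cop-advances
      -- Any vertex of `S` is a safe start, since the killer has to begin elsewhere.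
      (let c , s , _ = escape v in c , λ k k≢c → s , k≢c ∘ sym)
  , killer-survives X neighbour {I} (λ c k → S? k ×-dec ¬? (k ≟ c) ×-dec ¬? (k ~? c))
      (λ (_ , _ , k≁c) c~k → k≁c (~-sym c~k)) killer-advances
      (λ c → let k , s , k≢c , k≁c = escape c in k , k≢c , s , k≢c , k≁c)
  where
  open Graph X
  open EvasiveSet E

  J I : V → V → Set
  J c k = S c × c ≢ k
  I c k = S k × k ≢ c × ¬ k ~ c

  cop-advances : ∀ {c k} → J c k →
    ∃ λ c′ → c ~ c′ × (c′ ≡ k ⊎ (∀ k′ → k ~ k′ → k′ ≢ c′ × J c′ k′))
  cop-advances {c} {k} (s , c≢k) with c ~? k
  ... | yes c~k = k , c~k , inj₁ refl
  ... | no c≁k =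
    let c′ , c~c′ , s′ , c′≁k = evade s c≢k c≁k in
    c′ , c~c′ , inj₂ λ k′ k~k′ →
      (λ { refl → c′≁k (~-sym k~k′) }) , s′ , (λ { refl → c′≁k (~-sym k~k′) })

  killer-advances : ∀ {c k c′} → I c k → c ~ c′ →
    ∃ λ k′ → k ~ k′ × (k′ ≡ c′ ⊎ I c′ k′)
  killer-advances {c} {k} {c′} (s , k≢c , k≁c) c~c′ with k ~? c′
  ... | yes k~c′ = c′ , k~c′ , inj₁ refl
  ... | no k≁c′ =
    let k′ , k~k′ , s′ , k′≁c′ = evade s (λ { refl → k≁c (~-sym c~c′) }) k≁c′ in
    k′ , k~k′ , inj₂ (s′ , (λ eq → k≁c′ (subst (k ~_) eq k~k′)) , k′≁c′)

-- Retrograde analysis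

module _ (X : Graph) where
  open Graph X

  -- The killer, to answer the cop's next move, can catch her in at most n rounds.
  -- Losing to the cop needs no clause: adjacent positions are never forced, since
  -- a cop stepping onto the killer leaves him adjacent to her.
  Forced : ℕ → V → V → Set
  Forced zero    c k = ⊥
  Forced (suc n) c k = ∀ c′ → c ~ c′ → ∃ λ k′ → k ~ k′ × (k′ ≡ c′ ⊎ Forced n c′ k′)

  KillerForces : Set
  KillerForces = ∃ λ N → ∀ c → ∃ λ k → k ≢ c × Forced N c k

  -- A catch by the cop is no exit here: in the tensor product, catching the killer in one
  -- coordinate does not end the game, and she must be able to carry on in that factor.
  record CopSafe : Set₁ where
    field
      Safe    : V → V → Set
      safe?   : Binary.Decidable Safe
      advance : ∀ {c k} → Safe c k →
        ∃ λ c′ → c ~ c′ × (∀ k′ → k ~ k′ → k′ ≢ c′ × Safe c′ k′)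
      begin   : ∃ λ c → ∀ k → k ≢ c → Safe c k

module _ {X : Graph} where
  open Graph X
  open Finite finite
  open Game X

  forced? : ∀ n c → Decidable (Forced X n c)
  forced? zero    c k = no λ ()
  forced? (suc n) c k = all? λ c′ → (c ~? c′) →-dec
    any? λ k′ → (k ~? k′) ×-dec ((k′ ≟ c′) ⊎-dec forced? n c′ k′)

  forced-suc : ∀ n {c k} → Forced X n c k → Forced X (suc n) c k
  forced-suc (suc n) f c′ c~c′ =
    let k′ , k~k′ , g = f c′ c~c′ in k′ , k~k′ , map₂ (forced-suc n) g

  -- If the cop steps onto the killer, his reply leaves him adjacent to her with a smaller bound,
  -- until the bound runs out.
  forced⇒apart : ∀ n {c k} → Forced X n c k → ¬ c ~ k
  forced⇒apart (suc n) f c~k with f _ c~k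
  ... | _ , k~k  , inj₁ refl = ~-irrefl k~k
  ... | _ , k~k′ , inj₂ g    = forced⇒apart n g k~k′

  forced-stabilises : ∃ λ N → ∀ c k → Forced X (suc N) c k → Forced X N c k
  forced-stabilises =
    -- `X □ X` is taken for its enumeration of the pairs of vertices.
    let N , stable = Finite.stabilises (Graph.finite (X □ X))
                       (λ n (c , k) → Forced X n c k) (λ n (c , k) → forced? n c k) (λ n → forced-suc n)
    in N , λ c k → stable (c , k)

  -- Let `N` be where the forced positions stop growing. If every cop move from a position allowed a
  -- capture or a reply into `Forced N`, the position would be in `Forced (suc N)`, hence in
  -- `Forced N`; so outside `Forced N` she always has a safe move.
  killer-forces-or-cop-safe : KillerForces X ⊎ CopSafe X
  killer-forces-or-cop-safe
    with forced-stabilises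
  ... | N , stable with all? (λ c → any? λ k → ¬? (k ≟ c) ×-dec forced? N c k)
  ... | yes forces = inj₁ (N , forces)
  ... | no ¬forces = inj₂ record
    { Safe    = λ c k → ¬ Forced X N c k
    ; safe?   = λ c k → ¬? (forced? N c k)
    ; advance = λ {c} {k} ¬f → decidable-stable
        (any? λ c′ → (c ~? c′) ×-dec
          all? λ k′ → (k ~? k′) →-dec (¬? (k′ ≟ c′) ×-dec ¬? (forced? N c′ k′)))
        λ ¬advance → ¬f $ stable c k λ c′ c~c′ → decidable-stable
          (any? λ k′ → (k ~? k′) ×-dec ((k′ ≟ c′) ⊎-dec forced? N c′ k′))
          λ ¬reply → ¬advance $ c′ , c~c′ , λ k′ k~k′ →
              (λ k′≡c′ → ¬reply (k′ , k~k′ , inj₁ k′≡c′))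
            , (λ f → ¬reply (k′ , k~k′ , inj₂ f))
    ; begin   =
        let c , ¬forces-c = ¬∀⇒∃¬ (λ c → any? λ k → ¬? (k ≟ c) ×-dec forced? N c k) ¬forces
        in c , λ k k≢c f → ¬forces-c (k , k≢c , f)
    }

  module _ (neighbour : NoIsolated X) where

    killer-forces⇒killer-win : KillerForces X → KillerWin X
    killer-forces⇒killer-win (N , begin) = τ , λ σ →
      let open Run σ in run N 0 (ℕ.+-identityʳ N) (proj₂ (proj₂ (begin (CopStrategy.start σ)))) λ _ ()
      where
      goal? : ∀ n c′ → Decidable (λ k′ → k′ ≡ c′ ⊎ Forced X n c′ k′)
      goal? n c′ k′ = (k′ ≟ c′) ⊎-dec forced? n c′ k′

      τ : KillerStrategy
      τ = record
        { start = λ c → let k , k≢c , _ = begin c in k , k≢c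
        ; move  = λ past _ k c′ →
            -- In round `i` the history has length `i`, so this is the bound left after the present
            -- round.
            proj₁ (respond X neighbour k (goal? (N ∸ suc (length past)) c′)) }

      module Run (σ : CopStrategy) where
        open Play σ τ hiding (KillerWins)
        module σ = CopStrategy σ

        cop-moves : ∀ i → cop i ~ cop (suc i)
        cop-moves i = proj₂ (σ.move (proj₁ (round i)) (cop i) (killer i))

        length-past : ∀ i → length (proj₁ (round i)) ≡ i
        length-past zero    = refl
        length-past (suc i) = cong suc (length-past i)

        reply : ∀ n i → n + suc i ≡ N → Forced X (suc n) (cop i) (killer i) →
          KillerCatches i ⊎ Forced X n (cop (suc i)) (killer (suc i))
        reply n i n+1+i≡N f = subst
          (λ m → KillerCatches i ⊎ Forced X m (cop (suc i)) (killer (suc i)))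
          rank
          (proj₂ (respond X neighbour (killer i) (goal? _ (cop (suc i))))
            (subst (λ m → ∃ λ k′ → killer i ~ k′ ×
                             (k′ ≡ cop (suc i) ⊎ Forced X m (cop (suc i)) k′))
                   (sym rank) (f _ (cop-moves i))))
          where
          rank : N ∸ suc (length (proj₁ (round i))) ≡ n
          rank = trans (cong (λ m → N ∸ suc m) (length-past i))
                   (trans (cong (_∸ suc i) (sym n+1+i≡N)) (ℕ.m+n∸n≡m n (suc i)))

        -- The bound `n` falls as `i` rises and cannot reach zero without a capture, because
        -- `Forced zero` is empty.
        run : ∀ n i → n + i ≡ N → Forced X n (cop i) (killer i) →
          (∀ j → j < i → ¬ CopCatches j) → KillerWins σ τ
        run (suc n) i n+i≡N f free =
          [ (λ caught → i , caught , λ j → free′ j ∘ s≤s)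
          , (λ g → run n (suc i) n+1+i≡N g free′) ]′
          (reply n i n+1+i≡N f)
          where
          n+1+i≡N : n + suc i ≡ N
          n+1+i≡N = trans (ℕ.+-suc n i) n+i≡N

          free′ : ∀ j → j < suc i → ¬ CopCatches j
          free′ j j<1+i with ℕ.m<1+n⇒m<n∨m≡n j<1+i
          ... | inj₁ j<i  = free j j<i
          -- A catch in round `i` itself would need adjacent players at its beginning.
          ... | inj₂ refl = λ caught →
            forced⇒apart (suc n) f (subst (cop i ~_) caught (cop-moves i))

    cop-safe⇒cop-survives : CopSafe X → Σ CopStrategy λ σ → ∀ τ → ¬ KillerWins σ τ
    cop-safe⇒cop-survives E = cop-survives X neighbour safe?
      (λ s → let c′ , c~c′ , safe = advance s in c′ , c~c′ , inj₂ safe) begin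
      where open CopSafe E

    cop-safe⇒¬killer-win : CopSafe X → ¬ KillerWin X
    cop-safe⇒¬killer-win E (τ , wins) =
      let σ , survives = cop-safe⇒cop-survives E in survives τ (wins σ)

    ¬killer-win⇒cop-safe : ¬ KillerWin X → CopSafe X
    ¬killer-win⇒cop-safe ¬win =
      [ (λ forces → contradiction (killer-forces⇒killer-win forces) ¬win) , id ]′
      killer-forces-or-cop-safe

-- Products

⊗-no-isolated : ∀ G H → NoIsolated G → NoIsolated H → NoIsolated (G ⊗ H)
⊗-no-isolated G H nG nH (g , h) =
  let g′ , g~g′ = nG g ; h′ , h~h′ = nH h in (g′ , h′) , g~g′ , h~h′

□-no-isolated : ∀ G H → NoIsolated G → NoIsolated (G □ H)
□-no-isolated G H nG (g , h) = let g′ , g~g′ = nG g in (g′ , h) , inj₂ (g~g′ , refl)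

⊠-no-isolated : ∀ G H → NoIsolated G → NoIsolated (G ⊠ H)
⊠-no-isolated G H nG (g , h) = let g′ , g~g′ = nG g in (g′ , h) , inj₁ (inj₂ (g~g′ , refl))

-- The tensor product

module Tensor (G H : Graph) (nG : NoIsolated G) (nH : NoIsolated H) where
  private
    module G = Graph G
    module H = Graph H
  open Game (G ⊗ H)

  -- The killer copies the cop's moves in `H`, so a capture in `G` is a capture in the product.
  forced-left : ∀ n {c k} h → Forced G n c k → Forced (G ⊗ H) n (c , h) (k , h)
  forced-left (suc n) h f (c′ , h′) (c~c′ , h~h′) =
    let k′ , k~k′ , g = f c′ c~c′ in
    (k′ , h′) , (k~k′ , h~h′) ,
      [ inj₁ ∘ cong (_, h′) , inj₂ ∘ forced-left n h′ ]′ g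

  forced-right : ∀ n {c k} g → Forced H n c k → Forced (G ⊗ H) n (g , c) (g , k)
  forced-right (suc n) g f (g′ , c′) (g~g′ , c~c′) =
    let k′ , k~k′ , f′ = f c′ c~c′ in
    (g′ , k′) , (g~g′ , k~k′) ,
      [ inj₁ ∘ cong (g′ ,_) , inj₂ ∘ forced-right n g′ ]′ f′

  killer-forces : KillerForces G ⊎ KillerForces H → KillerForces (G ⊗ H)
  killer-forces (inj₁ (N , begin)) = N , λ (c , h) →
    let k , k≢c , f = begin c in (k , h) , k≢c ∘ cong proj₁ , forced-left N h f
  killer-forces (inj₂ (N , begin)) = N , λ (g , c) →
    let k , k≢c , f = begin c in (g , k) , k≢c ∘ cong proj₂ , forced-right N g f

  -- A move of the killer projects to a move in each factor, so safety in one factor persists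
  -- whatever the other coordinate does. Distinct starting vertices differ in some coordinate, which
  -- selects the factor.
  cop-safe : CopSafe G → CopSafe H → CopSafe (G ⊗ H)
  cop-safe EG EH = record
    { Safe    = λ (c , d) (k , l) → EG.Safe c k ⊎ EH.Safe d l
    ; safe?   = λ (c , d) (k , l) → EG.safe? c k ⊎-dec EH.safe? d l
    ; advance = λ
        { {_ , d} (inj₁ s) →
            let c′ , c~c′ , safe = EG.advance s ; d′ , d~d′ = nH d in
            (c′ , d′) , (c~c′ , d~d′) , λ (k′ , _) (k~k′ , _) →
              let k′≢c′ , s′ = safe k′ k~k′ in k′≢c′ ∘ cong proj₁ , inj₁ s′
        ; {c , _} (inj₂ s) →
            let d′ , d~d′ , safe = EH.advance s ; c′ , c~c′ = nG c in
            (c′ , d′) , (c~c′ , d~d′) , λ (_ , l′) (_ , l~l′) →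
              let l′≢d′ , s′ = safe l′ l~l′ in l′≢d′ ∘ cong proj₂ , inj₂ s′ }
    ; begin   =
        let c , safe-c = EG.begin ; d , safe-d = EH.begin in
        (c , d) , λ (k , l) ≢cd → begin-safe safe-c safe-d ≢cd (k G.≟ c)
    }
    where
    module EG = CopSafe EG
    module EH = CopSafe EH

    begin-safe : ∀ {c d k l} → (∀ k → k ≢ c → EG.Safe c k) → (∀ l → l ≢ d → EH.Safe d l) →
      (k , l) ≢ (c , d) → Dec (k ≡ c) → EG.Safe c k ⊎ EH.Safe d l
    begin-safe _ safe-d ≢cd (yes refl) = inj₂ (safe-d _ (≢cd ∘ cong (_ ,_)))
    begin-safe safe-c _ _   (no k≢c)   = inj₁ (safe-c _ k≢c)

  -- Copying the cop in `H` keeps the `H`-coordinates equal at the beginning of each round, and such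
  -- vertices are never adjacent in the product.
  killer-survives-⊗ : (∀ g → ∃ (_≢ g)) → Σ KillerStrategy λ τ → ∀ σ → ¬ CopWins σ τ
  killer-survives-⊗ other = killer-survives (G ⊗ H) (⊗-no-isolated G H nG nH)
    {λ (_ , d) (_ , l) → l ≡ d} (λ (_ , d) (_ , l) → l H.≟ d)
    (λ { refl (_ , d~d) → H.~-irrefl d~d })
    (λ { {_} {k , _} {_ , d′} refl (_ , d~d′) →
         let k′ , k~k′ = nG k in (k′ , d′) , (k~k′ , d~d′) , inj₂ refl })
    (λ (c , d) → let k , k≢c = other c in (k , d) , k≢c ∘ cong proj₁ , refl)

-- The strong product

module Strong (G H : Graph) (nG : NoIsolated G) (nH : NoIsolated H) where
  private
    module G = Graph G
    module H = Graph H
    module GH = Graph (G ⊠ H)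
  open Game (G ⊠ H)

  -- Closed neighbourhoods: vertices of the strong product are equal or adjacent iff they are close
  -- in both coordinates.
  Close : (X : Graph) → Graph.V X → Graph.V X → Set
  Close X x y = x ≡ y ⊎ Graph._~_ X x y

  close? : (X : Graph) → Binary.Decidable (Close X)
  close? X x y = Graph._≟_ X x y ⊎-dec Graph._~?_ X x y

  ~⇒close : ∀ {x y} → x GH.~ y → Close G (proj₁ x) (proj₁ y) × Close H (proj₂ x) (proj₂ y)
  ~⇒close (inj₁ (inj₁ (g≡ , h~))) = inj₁ g≡ , inj₂ h~
  ~⇒close (inj₁ (inj₂ (g~ , h≡))) = inj₂ g~ , inj₁ h≡
  ~⇒close (inj₂ (g~ , h~))        = inj₂ g~ , inj₂ h~

  close⇒~ : ∀ {x y} → x ≢ y → Close G (proj₁ x) (proj₁ y) → Close H (proj₂ x) (proj₂ y) →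
    x GH.~ y
  close⇒~ x≢y (inj₁ refl) (inj₁ refl) = contradiction refl x≢y
  close⇒~ _   (inj₁ g≡)   (inj₂ h~)   = inj₁ (inj₁ (g≡ , h~))
  close⇒~ _   (inj₂ g~)   (inj₁ h≡)   = inj₁ (inj₂ (g~ , h≡))
  close⇒~ _   (inj₂ g~)   (inj₂ h~)   = inj₂ (g~ , h~)

  evade : ∀ {x y} → x ≢ y → ¬ x GH.~ y → ∃ λ x′ → x GH.~ x′ × ¬ x′ GH.~ y
  evade {g , h} {g′ , _} x≢y x≁y
    with separate (λ (cg , ch) → x≁y (close⇒~ x≢y cg ch)) (close? G g g′)
  ... | inj₁ ¬cg = let h₁ , h~h₁ = nH h in
    (g , h₁) , inj₁ (inj₁ (refl , h~h₁)) , ¬cg ∘ proj₁ ∘ ~⇒close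
  ... | inj₂ ¬ch = let g₁ , g~g₁ = nG g in
    (g₁ , h) , inj₁ (inj₂ (g~g₁ , refl)) , ¬ch ∘ proj₂ ∘ ~⇒close

  universal-⊠⁺ : HasUniversalVertex G × HasUniversalVertex H → HasUniversalVertex (G ⊠ H)
  universal-⊠⁺ ((u , adj-u) , w , adj-w) = (u , w) , λ (g , h) ≢uw →
    close⇒~ (≢uw ∘ sym) (close G adj-u g) (close H adj-w h)
    where
    close : ∀ X {v} → (∀ x → x ≢ v → Graph._~_ X v x) → ∀ x → Close X v x
    close X {v} adj x with Graph._≟_ X x v
    ... | yes refl = inj₁ refl
    ... | no x≢v   = inj₂ (adj x x≢v)

  universal-⊠⁻ : HasUniversalVertex (G ⊠ H) → HasUniversalVertex G × HasUniversalVertex H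
  universal-⊠⁻ ((u , w) , adj) =
      (u , λ g g≢u → [ (λ u≡g → contradiction (sym u≡g) g≢u) , id ]′
                       (proj₁ (~⇒close (adj (g , w) (g≢u ∘ cong proj₁)))))
    , (w , λ h h≢w → [ (λ w≡h → contradiction (sym w≡h) h≢w) , id ]′
                       (proj₂ (~⇒close (adj (u , h) (h≢w ∘ cong proj₂)))))

  evasive : ¬ (HasUniversalVertex G × HasUniversalVertex H) → EvasiveSet (G ⊠ H)
  evasive ¬universal = record
    { S      = λ _ → ⊤
    ; S?     = λ _ → yes tt
    ; evade  = λ _ x≢y x≁y →
        let x′ , x~x′ , x′≁y = evade x≢y x≁y in x′ , x~x′ , tt , x′≁y
    ; escape = λ y → decidable-stable
        (any? λ x → yes tt ×-dec ¬? (x GH.≟ y) ×-dec ¬? (x GH.~? y))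
        -- A vertex `y` without an escaping `x` is universal in the product, so both factors have
        -- universal vertices.
        λ ¬escape → ¬universal $ universal-⊠⁻ $ y , λ x x≢y → decidable-stable
          (y GH.~? x) λ y≁x → ¬escape (x , tt , x≢y , λ x~y → y≁x (GH.~-sym {x} {y} x~y))
    }
    where open Finite GH.finite

-- The killer has to start on a neighbour of `u`, so the cop catches him with her first move.
universal⇒cop-win : (X : Graph) → NoIsolated X → HasUniversalVertex X → CopWin X
universal⇒cop-win X neighbour (u , adj) = σ , λ τ →
  0 , proj₂ (respond X neighbour u (_≟ proj₁ (Game.KillerStrategy.start τ u)))
        (_ , adj _ (proj₂ (Game.KillerStrategy.start τ u)) , refl) , λ _ ()
  where
  open Graph X
  open Game X

  σ : CopStrategy
  σ = record { start = u ; move = λ _ c k → proj₁ (respond X neighbour c (_≟ k)) }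

-- The Cartesian product

-- Minimum degree two inside S: whichever j is forbidden, i has a neighbour in S
-- other than j.  Stated for Subset because ¬ IsTree only yields ¬ ¬ Cycle, and
-- the search over all subsets makes the existence of a core stable.
IsCore : (X : Graph) → Subset (Graph.order X) → Set
IsCore X S = (∃ (_∈ S)) × (∀ i → i ∈ S → ∀ j → ∃ λ l → l ∈ S × from i ~ from l × l ≢ j)
  where
  open Graph X
  open Finite finite

is-core? : (X : Graph) → Decidable (IsCore X)
is-core? X S = Fin.any? (_∈? S) ×-dec Fin.all? λ i → (i ∈? S) →-dec
    Fin.all? λ j → Fin.any? λ l → (l ∈? S) ×-dec (from i ~? from l) ×-dec ¬? (l Fin.≟ j)
  where
  open Graph X
  open Finite finite

module _ {X : Graph} (C : Cycle X) where
  open Graph X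
  open Finite finite
  open Cycle C

  -- The successor and the predecessor along the cycle, distinct because it has at least three
  -- vertices.
  cycle-neighbours : ∀ i → ∃ λ j → ∃ λ l → j ≢ l × vertex i ~ vertex j × vertex i ~ vertex l
  cycle-neighbours zero =
    suc zero , fromℕ (2 + k) , (λ ()) , step zero , ~-sym close
  cycle-neighbours (suc i) with view i
  ... | ‵fromℕ =
    inject₁ (fromℕ (1 + k)) , zero , (λ ()) , ~-sym (step (fromℕ (1 + k))) , close
  ... | ‵inject₁ i′ =
    suc (suc i′) , inject₁ (inject₁ i′) , distinct i′ , step (suc i′) , ~-sym (step (inject₁ i′))
    where
    distinct : ∀ {n} (i : Fin n) → suc (suc i) ≢ inject₁ (inject₁ i)
    distinct (suc i) = distinct i ∘ Fin.suc-injective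

  -- The vertex set of the cycle works: at most one of the two neighbours along it is the forbidden
  -- `j`.
  cycle⇒core : ∃ (IsCore X)
  cycle⇒core = comprehension on-cycle? , (to (vertex zero) , member zero) , λ i i∈ j →
    let a , eq = ∈-comprehension⁻ on-cycle? i∈ ; l , l≢j , a~l = avoid a j in
    to (vertex l) , member l , adjacent eq a~l , l≢j
    where
    on-cycle? : Decidable (λ i → ∃ λ a → to (vertex a) ≡ i)
    on-cycle? i = Fin.any? λ a → to (vertex a) Fin.≟ i

    member : ∀ a → to (vertex a) ∈ comprehension on-cycle?
    member a = ∈-comprehension⁺ on-cycle? (a , refl)

    adjacent : ∀ {a l i} → to (vertex a) ≡ i → vertex a ~ vertex l →
      from i ~ from (to (vertex l))
    adjacent {a} {l} refl a~l
      rewrite from∘to (vertex a) | from∘to (vertex l) = a~l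

    avoid : ∀ a j → ∃ λ l → to (vertex l) ≢ j × vertex a ~ vertex l
    avoid a j with cycle-neighbours a
    ... | l , l′ , l≢l′ , a~l , a~l′ with to (vertex l) Fin.≟ j
    ... | no ≢j    = l , ≢j , a~l
    ... | yes refl = l′ , (λ eq → l≢l′ (sym (injective (to-injective eq)))) , a~l′
      where
      to-injective : ∀ {x y} → to x ≡ to y → x ≡ y
      to-injective {x} {y} eq = trans (sym (from∘to x)) (trans (cong from eq) (from∘to y))

¬tree⇒core : ∀ {X} → Connected X → ¬ IsTree X → ∃ (IsCore X)
¬tree⇒core {X} conn ¬tree = decidable-stable (anySubset? (is-core? X))
  (¬¬-map cycle⇒core λ ¬cycle → ¬tree (conn , ¬cycle))

module Cartesian (G H : Graph) where
  private
    module G = Graph G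
    module H = Graph H
  open Finite G.finite

  -- Vertices that differ in both coordinates are neither equal nor adjacent in the Cartesian
  -- product, so each move aims at that.
  evasive-left : NoIsolated H → (∀ h → ∃ (_≢ h)) → ∃ (IsCore G) → EvasiveSet (G □ H)
  evasive-left nH other (core , (i₀ , i₀∈) , turn) = record
    { S = S ∘ proj₁ ; S? = λ (g , _) → to g ∈? core ; evade = evade ; escape = escape }
    where
    S : G.V → Set
    S g = to g ∈ core

    avoid : ∀ {g} → S g → ∀ a → ∃ λ g′ → S g′ × g G.~ g′ × g′ ≢ a
    avoid {g} s a =
      let l , l∈ , g~l , l≢a = turn (to g) s (to a) in
        from l , subst (_∈ core) (sym (to∘from l)) l∈
      , subst (G._~ from l) (from∘to g) g~l
      , λ eq → l≢a (trans (sym (to∘from l)) (cong to eq))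

    evade : ∀ {x y} → S (proj₁ x) → x ≢ y → ¬ CartesianAdj G H x y →
      ∃ λ x′ → CartesianAdj G H x x′ × S (proj₁ x′) × ¬ CartesianAdj G H x′ y
    evade {g , h} {g′ , h′} s x≢y _ with h H.≟ h′
    -- The `G`-coordinates differ already, and any step in `H` makes the `H`-coordinates differ too.
    ... | yes refl = let b , h~b = nH h in
      (g , b) , inj₁ (refl , h~b) , s ,
        [ (λ (g≡g′ , _) → x≢y (cong (_, h) g≡g′))
        , (λ (_ , b≡h) → H.~-irrefl (subst (h H.~_) b≡h h~b)) ]′
    -- The `H`-coordinates differ already, and the core offers a step in `G` that avoids `g′`.
    ... | no h≢h′ = let a , sₐ , g~a , a≢g′ = avoid s g′ in
      (a , h) , inj₂ (g~a , refl) , sₐ , [ a≢g′ ∘ proj₁ , h≢h′ ∘ proj₂ ]′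

    escape : ∀ y → ∃ λ x → S (proj₁ x) × x ≢ y × ¬ CartesianAdj G H x y
    escape (g , h) =
      let s₀ = subst (_∈ core) (sym (to∘from i₀)) i₀∈
          b , b≢h = other h
          -- The given core member may be `g` itself, so a core neighbour of it other than `g` is
          -- taken.
          a , s , a≢g = elsewhere s₀ in
      (a , b) , s , a≢g ∘ cong proj₁ , [ a≢g ∘ proj₁ , b≢h ∘ proj₂ ]′
      where
      elsewhere : ∀ {a} → S a → ∃ λ a′ → S a′ × a′ ≢ g
      elsewhere s = let a′ , s′ , _ , a′≢g = avoid s g in a′ , s′ , a′≢g

□-swap : ∀ G H {x y} → CartesianAdj G H x y → CartesianAdj H G (swap x) (swap y)
□-swap G H = [ inj₂ ∘ swap , inj₁ ∘ swap ]′

evasive-swap : ∀ G H → EvasiveSet (G □ H) → EvasiveSet (H □ G)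
evasive-swap G H E = record
  { S      = S ∘ swap
  ; S?     = S? ∘ swap
  ; evade  = λ s x≢y x≁y →
      let x′ , x~x′ , s′ , x′≁y = evade s (x≢y ∘ cong swap) (x≁y ∘ □-swap G H)
      in swap x′ , □-swap G H x~x′ , s′ , x′≁y ∘ □-swap H G
  ; escape = λ y →
      let x , s , x≢y , x≁y = escape (swap y)
      in swap x , s , x≢y ∘ cong swap , x≁y ∘ □-swap H G
  }
  where open EvasiveSet E

corollary1 : (G H : Graph) → Connected G → Connected H →
    1 < ∣ G ∣ᵍ → 1 < ∣ H ∣ᵍ →
    ((¬ IsTree G) ⊎ (¬ IsTree H) → Stalemate (G □ H))
    × ((¬ KillerWin G) × (¬ KillerWin H) → Stalemate (G ⊗ H))
    × (¬ ((¬ KillerWin G) × (¬ KillerWin H)) → KillerWin (G ⊗ H))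
    × (HasUniversalVertex G × HasUniversalVertex H → CopWin (G ⊠ H))
    × (¬ (HasUniversalVertex G × HasUniversalVertex H) → Stalemate (G ⊠ H))
corollary1 G H connG connH 1<G 1<H =
    evasive⇒stalemate (G □ H) (□-no-isolated G H nG) v ∘
      [ Cartesian.evasive-left G H nH (other-vertex H 1<H) ∘ ¬tree⇒core connG
      , evasive-swap H G ∘
          Cartesian.evasive-left H G nG (other-vertex G 1<G) ∘ ¬tree⇒core connH ]′
  , (λ (¬winG , ¬winH) →
        cop-safe⇒cop-survives n⊗
          (T.cop-safe (¬killer-win⇒cop-safe nG ¬winG) (¬killer-win⇒cop-safe nH ¬winH))
      , T.killer-survives-⊗ (other-vertex G 1<G))
  -- The hypothesis does not say which factor is killer-win. The dichotomy decides this for each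
  -- factor, and two cop-safe factors contradict the hypothesis.
  , (λ ¬neither → killer-forces⇒killer-win n⊗ (T.killer-forces
      ([ inj₁ , (λ safeG → [ inj₂ , (λ safeH → contradiction
           (cop-safe⇒¬killer-win nG safeG , cop-safe⇒¬killer-win nH safeH) ¬neither) ]′
           killer-forces-or-cop-safe) ]′
         killer-forces-or-cop-safe)))
  , universal⇒cop-win (G ⊠ H) n⊠ ∘ S.universal-⊠⁺
  , evasive⇒stalemate (G ⊠ H) n⊠ v ∘ S.evasive
  where
  nG = no-isolated G connG 1<G
  nH = no-isolated H connH 1<H
  n⊗ = ⊗-no-isolated G H nG nH
  n⊠ = ⊠-no-isolated G H nG
  v = some-vertex G 1<G , some-vertex H 1<H
  module T = Tensor G H nG nH
  module S = Strong G H nG nH
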